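{- For all constants $\alpha\ge1$ and $\beta\ge1$, there exists a related-machines instance with cardinality budget $\Gamma=1$ (i.e. machine speeds, intervals $[p_j^-,p_j^+]$ defining the uncertainty set $\mathcal U$ with $\Gamma=1$, and a predicted scenario $\hat q\in\mathcal U$) such that no randomized algorithm is both $\alpha$-consistent and $\beta$-robust on it; that is, there is no random schedule $\mathcal S$ with $$\mathbb E[C_{\max}(\mathcal S,\hat q)]\le\alpha\,\mathrm{OPT}(\hat q)\quad\text{and}\quad \mathbb E[C_{\max}(\mathcal S,q)]\le\beta\,\mathrm{OPT}^{\mathrm{rob}}(\mathcal U)\ \text{ for all } q\in\mathcal U.$$
   Context: There are $m$ machines and $n$ jobs. Related machines: each job $j$ has a size $p_j\ge0$, each machine $i$ has a speed $s_i>0$, and the processing time of job $j$ on machine $i$ is $q_{i,j}=p_j/s_i$; a scenario is the resulting matrix $q$. A schedule is a partition $\mathcal S=(S_1,\dots,S_m)$ of $[n]$ (parts may be empty), and $C_{\max}(\mathcal S,q)=\max_{i}\sum_{j\in S_i}q_{i,j}$. $\mathrm{OPT}(q)=\min_{\mathcal S}C_{\max}(\mathcal S,q)$ and $\mathrm{OPT}^{\mathrm{rob}}(\mathcal U)=\min_{\mathcal S}\max_{q\in\mathcal U}C_{\max}(\mathcal S,q)$, minima over deterministic schedules. Cardinality-budget uncertainty: for given $0\le p_j^-\le p_j^+$ and an integer $\Gamma\ge1$, $\mathcal U$ is the set of all scenarios obtained (with fixed speeds) from size vectors $p$ for which there is $T\subseteq[n]$ with $|T|\le\Gamma$, $p_j=p_j^-$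 for $j\notin T$ and $p_j\in[p_j^-,p_j^+]$ for $j\in T$. A randomized algorithm returns, on input $(\mathcal U,\hat q)$, a random schedule; its consistency and robustness are measured in expectation, with the scenario $q$ chosen independently of the algorithm's randomness. -}

module Defs where

open import Algebra.Bundles using (CommutativeRing; Monoid)
open import Algebra.Structures using (IsCommutativeRing)
import Algebra.Definitions.RawMonoid as RawMonoidDefs
open import Data.Bool.Base using (if_then_else_)
open import Data.Fin.Base using (Fin; zero; suc; finToFun)
open import Data.Fin.Properties using (_≟_)
open import Data.Fin.Subset using (Subset; _∈_; _∉_; ∣_∣)
import Data.List.Base as List
import Data.List.Extrema as Extrema
open import Data.Nat.Base as ℕ using (ℕ)
open import Data.Product.Base using (Σ-syntax; ∃-syntax; _×_)
open import Function.Base using (_∘_)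
open import Level using (Level; _⊔_) renaming (suc to lsuc)
open import Relation.Binary.Bundles using (TotalOrder)
open import Relation.Binary.Core using (Rel)
import Relation.Binary.Construct.NonStrictToStrict as NonStrictToStrict
open import Relation.Binary.Structures using (IsTotalOrder)
open import Relation.Nullary.Decidable.Core using (does)
open import Relation.Nullary.Negation.Core using (¬_)

-- The standard library has no real numbers: sizes, speeds, probabilities and the
-- constants α, β all live in an arbitrary Archimedean totally ordered field,
-- of which ℝ (with its classical total order) and ℚ are examples.

record ArchimedeanOrderedField (c ℓ₁ ℓ₂ : Level) : Set (lsuc (c ⊔ ℓ₁ ⊔ ℓ₂)) where
  infix  8 -_
  infixl 9 _⁻¹
  infixl 7 _*_ _/_
  infixl 6 _+_
  infix  4 _≈_ _≤_
  field
    Carrier           : Set c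
    _≈_               : Rel Carrier ℓ₁
    _≤_               : Rel Carrier ℓ₂
    _+_ _*_           : Carrier → Carrier → Carrier
    -_                : Carrier → Carrier
    0# 1#             : Carrier
    _⁻¹               : Carrier → Carrier
    isCommutativeRing : IsCommutativeRing _≈_ _+_ _*_ -_ 0# 1#
    isTotalOrder      : IsTotalOrder _≈_ _≤_
    0≉1               : ¬ 0# ≈ 1#
    -- The inverse is total; 0# ⁻¹ is unconstrained.
    ⁻¹-inverseʳ       : ∀ x → ¬ x ≈ 0# → x * x ⁻¹ ≈ 1#
    +-monoʳ-≤         : ∀ x {y z} → y ≤ z → x + y ≤ x + z
    *-nonNeg          : ∀ {x y} → 0# ≤ x → 0# ≤ y → 0# ≤ x * y

  commutativeRing : CommutativeRing c ℓ₁
  commutativeRing = record { isCommutativeRing = isCommutativeRing }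

  totalOrder : TotalOrder c ℓ₁ ℓ₂
  totalOrder = record { isTotalOrder = isTotalOrder }

  open RawMonoidDefs (Monoid.rawMonoid (CommutativeRing.+-monoid commutativeRing)) public
    using (sum) renaming (_×_ to _·_)

  field
    archimedean : ∀ x → ∃[ n ] x ≤ n · 1#

  open NonStrictToStrict _≈_ _≤_ public using (_<_)

  _/_ : Carrier → Carrier → Carrier
  x / y = x * y ⁻¹

module Scheduling {c ℓ₁ ℓ₂ : Level} (K : ArchimedeanOrderedField c ℓ₁ ℓ₂) where

  open ArchimedeanOrderedField K

  IsLeast IsGreatest : ∀ {ℓ} → (Carrier → Set ℓ) → Carrier → Set (c ⊔ ℓ₂ ⊔ ℓ)
  IsLeast    V v = V v × (∀ w → V w → v ≤ w)
  IsGreatest V v = V v × (∀ w → V w → w ≤ v)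

  maximum : ∀ {k} → (Fin (ℕ.suc k) → Carrier) → Carrier
  maximum f = Extrema.max totalOrder (f zero) (List.tabulate (f ∘ suc))

  Scenario : ℕ → ℕ → Set c
  Scenario m n = Fin m → Fin n → Carrier

  -- A partition (S₁, …, S_m) of the jobs into labelled, possibly empty parts,
  -- given by the machine of each job: S_i is the fibre over i.
  Schedule : ℕ → ℕ → Set
  Schedule m n = Fin n → Fin m

  load : ∀ {m n} → Schedule m n → Scenario m n → Fin m → Carrier
  load S q i = sum (λ j → if does (S j ≟ i) then q i j else 0#)

  Cmax : ∀ {m n} → Schedule (ℕ.suc m) n → Scenario (ℕ.suc m) n → Carrier
  Cmax S q = maximum (load S q)

  -- A sum over all schedules: finToFun is a bijection from Fin (m ^ n) onto
  -- the functions Fin n → Fin m (up to pointwise equality).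
  sumSchedules : ∀ {m n} → (Schedule m n → Carrier) → Carrier
  sumSchedules {m} {n} f = sum {m ℕ.^ n} (λ k → f (finToFun k))

  -- A random schedule is given by its law on the finite set of schedules.
  record RandomSchedule (m n : ℕ) : Set (c ⊔ ℓ₁ ⊔ ℓ₂) where
    field
      prob        : Schedule m n → Carrier
      prob-nonNeg : ∀ S → 0# ≤ prob S
      prob-total  : sumSchedules prob ≈ 1#

  𝔼 : ∀ {m n} → RandomSchedule m n → (Schedule m n → Carrier) → Carrier
  𝔼 𝒮 f = sumSchedules (λ S → RandomSchedule.prob 𝒮 S * f S)

  IsOPT : ∀ {m n} → Scenario (ℕ.suc m) n → Carrier → Set (c ⊔ ℓ₁ ⊔ ℓ₂)
  IsOPT {m} {n} q = IsLeast (λ v → Σ[ S ∈ Schedule (ℕ.suc m) n ] v ≈ Cmax S q)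

  IsWorstCase : ∀ {m n ℓ} → (Scenario (ℕ.suc m) n → Set ℓ) →
                Schedule (ℕ.suc m) n → Carrier → Set (c ⊔ ℓ₁ ⊔ ℓ₂ ⊔ ℓ)
  IsWorstCase 𝒰 S = IsGreatest (λ v → ∃[ q ] (𝒰 q × v ≈ Cmax S q))

  IsOPTrob : ∀ {m n ℓ} → (Scenario (ℕ.suc m) n → Set ℓ) →
             Carrier → Set (c ⊔ ℓ₁ ⊔ ℓ₂ ⊔ ℓ)
  IsOPTrob {m} {n} 𝒰 = IsLeast (λ v → Σ[ S ∈ Schedule (ℕ.suc m) n ] IsWorstCase 𝒰 S v)

  module _ {m n : ℕ} (speed : Fin m → Carrier) (p⁻ p⁺ : Fin n → Carrier) (Γ : ℕ) where

    BudgetedSizes : (Fin n → Carrier) → Set (ℓ₁ ⊔ ℓ₂)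
    BudgetedSizes p = Σ[ T ∈ Subset n ]
      ( ∣ T ∣ ℕ.≤ Γ
      × (∀ j → j ∉ T → p j ≈ p⁻ j)
      × (∀ j → j ∈ T → p⁻ j ≤ p j × p j ≤ p⁺ j))

    CardinalityBudget : Scenario m n → Set (c ⊔ ℓ₁ ⊔ ℓ₂)
    CardinalityBudget q = ∃[ p ] (BudgetedSizes p × (∀ i j → q i j ≈ p j / speed i))

  record Instance : Set (c ⊔ ℓ₁ ⊔ ℓ₂) where
    field
      m-1 n : ℕ

    m : ℕ
    m = ℕ.suc m-1

    field
      speed     : Fin m → Carrier
      speed-pos : ∀ i → 0# < speed i
      p⁻ p⁺     : Fin n → Carrier
      0≤p⁻      : ∀ j → 0# ≤ p⁻ j
      p⁻≤p⁺     : ∀ j → p⁻ j ≤ p⁺ j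
      Γ         : ℕ
      1≤Γ       : 1 ℕ.≤ Γ

    𝒰 : Scenario m n → Set (c ⊔ ℓ₁ ⊔ ℓ₂)
    𝒰 = CardinalityBudget speed p⁻ p⁺ Γ

    field
      q̂   : Scenario m n
      q̂∈𝒰 : 𝒰 q̂

  -- OPT and OPTrob are determined up to _≈_ by IsOPT and IsOPTrob, and always
  -- exist: there are finitely many schedules, and the worst case over 𝒰 is
  -- attained by raising the jobs of some T to p⁺. Since they are quantified
  -- universally here, refuting either property requires the actual optimum.
  module _ (I : Instance) where
    open Instance I

    Consistent : Carrier → RandomSchedule m n → Set (c ⊔ ℓ₁ ⊔ ℓ₂)
    Consistent α 𝒮 = ∀ opt → IsOPT q̂ opt → 𝔼 𝒮 (λ S → Cmax S q̂) ≤ α * opt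

    Robust : Carrier → RandomSchedule m n → Set (c ⊔ ℓ₁ ⊔ ℓ₂)
    Robust β 𝒮 = ∀ opt → IsOPTrob 𝒰 opt →
                 ∀ q → 𝒰 q → 𝔼 𝒮 (λ S → Cmax S q) ≤ β * opt

{-# OPTIONS --safe #-}
module Submission where

-- One machine of speed s and n machines of speed 1, with n jobs of size 1, one of
-- which may grow to 1 + n; all sizes are predicted to stay 1. Against the prediction
-- the optimum is at most 1, so consistency allows only about αs jobs on the fast
-- machine. If job j grows while on a slow machine, the makespan is at least n, so
--   n ≤ n [j is on the fast machine] + Cmax(S, q^j).
-- Summing over j and taking expectations gives
--   n² ≤ n s 𝔼[Cmax(S, q̂)] + Σⱼ 𝔼[Cmax(S, q^j)] ≤ n s α + n β (2n/s),
-- since putting every job on the fast machine shows OPTrob ≤ 2n/s. For s = 4β and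
-- n > 2sα this is a contradiction.

open import Defs
open import Algebra.Bundles using (CommutativeRing)
import Algebra.Properties.CommutativeMonoid.Sum as CommutativeMonoidSum
import Algebra.Properties.Ring as RingProperties
import Algebra.Properties.Semiring.Sum as SemiringSum
import Algebra.Solver.Ring.NaturalCoefficients.Default as SemiringSolver
open import Data.Bool.Base using (true; false; if_then_else_)
open import Data.Fin.Base using (Fin; zero; suc; finToFun; funToFin)
open import Data.Fin.Properties using (_≟_; any?; finToFun-funToFin)
open import Data.Fin.Subset using (_∈_; _∉_; ⊥; ⁅_⁆)
open import Data.Fin.Subset.Properties
  using (_∈?_; ∉⊥; ∣⊥∣≡0; x∈⁅x⁆; x∈⁅y⁆⇒x≡y; ∣⁅x⁆∣≡1; x∈p∧x≢y⇒x∈p-y; x∈p⇒∣p-x∣<∣p∣)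
open import Data.List.Base using (allFin; tabulate)
import Data.List.Extrema as Extrema
import Data.List.Relation.Unary.All as All
open import Data.List.Relation.Unary.All.Properties using (tabulate⁺; tabulate⁻)
open import Data.List.Membership.Propositional.Properties using (∈-allFin)
open import Data.Nat.Base as ℕ using (ℕ; s≤s; z≤n)
import Data.Nat.Properties as ℕₚ
open import Data.Product.Base using (Σ-syntax; ∃-syntax; _×_; _,_; proj₁; proj₂)
open import Data.Sum.Base using (inj₁; inj₂)
open import Function.Base using (_∘_; const)
open import Relation.Binary.Bundles using (TotalOrder)
import Relation.Binary.Reasoning.PartialOrder as PartialOrderReasoning
open import Relation.Binary.PropositionalEquality.Core as ≡ using (_≡_; _≢_)
open import Relation.Nullary.Decidable using (yes; no; does; dec-true)
open import Relation.Nullary.Negation.Core using (¬_; contradiction)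

-- Order, inverses and finite sums in an Archimedean ordered field.

module OrderedFieldProperties {c ℓ₁ ℓ₂} (K : ArchimedeanOrderedField c ℓ₁ ℓ₂) where

  open ArchimedeanOrderedField K
  open CommutativeRing commutativeRing public
    using ( refl; sym; trans; +-cong; +-congˡ; +-congʳ; *-congˡ; *-congʳ
          ; +-comm; +-assoc; +-identityˡ; +-identityʳ; *-comm; *-assoc
          ; *-identityˡ; *-identityʳ; distribˡ; distribʳ; zeroˡ; zeroʳ; -‿cong; -‿inverseʳ; -‿inverseˡ
          ; ring; semiring; commutativeSemiring; +-commutativeMonoid)
  open RingProperties ring using (-‿distribʳ-*; -‿involutive)
  open CommutativeMonoidSum +-commutativeMonoid public
    using (sum-cong-≋; sum-replicate-zero; ∑-distrib-+; ∑-comm)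
  open SemiringSum semiring public using (*-distribˡ-sum; *-distribʳ-sum)
  open TotalOrder totalOrder public
    using (total; antisym; poset) renaming (refl to ≤-refl; reflexive to ≤-reflexive; trans to ≤-trans)
  open PartialOrderReasoning poset

  +-mono-≤ : ∀ {x y u v} → x ≤ y → u ≤ v → x + u ≤ y + v
  +-mono-≤ {x} {y} {u} {v} x≤y u≤v = begin
    x + u  ≤⟨ +-monoʳ-≤ x u≤v ⟩
    x + v  ≈⟨ +-comm x v ⟩
    v + x  ≤⟨ +-monoʳ-≤ v x≤y ⟩
    v + y  ≈⟨ +-comm v y ⟩
    y + v  ∎

  +-cancelˡ-≤ : ∀ x {y z} → x + y ≤ x + z → y ≤ z
  +-cancelˡ-≤ x {y} {z} x+y≤x+z = begin
    y                ≈⟨ cancel y ⟨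
    - x + (x + y)    ≤⟨ +-monoʳ-≤ (- x) x+y≤x+z ⟩
    - x + (x + z)    ≈⟨ cancel z ⟩
    z                ∎
    where
    cancel : ∀ w → - x + (x + w) ≈ w
    cancel w = trans (sym (+-assoc _ _ _)) (trans (+-congʳ (-‿inverseˡ x)) (+-identityˡ w))

  x≤x+y : ∀ {x y} → 0# ≤ y → x ≤ x + y
  x≤x+y {x} {y} 0≤y = begin
    x       ≈⟨ +-identityʳ x ⟨
    x + 0#  ≤⟨ +-monoʳ-≤ x 0≤y ⟩
    x + y   ∎

  x≤y+x : ∀ {x y} → 0# ≤ y → x ≤ y + x
  x≤y+x 0≤y = ≤-trans (x≤x+y 0≤y) (≤-reflexive (+-comm _ _))

  +-nonNeg : ∀ {x y} → 0# ≤ x → 0# ≤ y → 0# ≤ x + y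
  +-nonNeg 0≤x 0≤y = ≤-trans 0≤x (x≤x+y 0≤y)

  neg-nonNeg : ∀ {x} → x ≤ 0# → 0# ≤ - x
  neg-nonNeg {x} x≤0 = +-cancelˡ-≤ x (begin
    x + 0#   ≈⟨ +-identityʳ x ⟩
    x        ≤⟨ x≤0 ⟩
    0#       ≈⟨ -‿inverseʳ x ⟨
    x + - x  ∎)

  *-monoˡ-≤ : ∀ {z} → 0# ≤ z → ∀ {x y} → x ≤ y → z * x ≤ z * y
  *-monoˡ-≤ {z} 0≤z {x} {y} x≤y = begin
    z * x                  ≤⟨ x≤x+y (*-nonNeg 0≤z 0≤y-x) ⟩
    z * x + z * (- x + y)  ≈⟨ distribˡ z x (- x + y) ⟨
    z * (x + (- x + y))    ≈⟨ *-congˡ (+-assoc x (- x) y) ⟨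
    z * ((x + - x) + y)    ≈⟨ *-congˡ (+-congʳ (-‿inverseʳ x)) ⟩
    z * (0# + y)           ≈⟨ *-congˡ (+-identityˡ y) ⟩
    z * y                  ∎
    where
    0≤y-x : 0# ≤ - x + y
    0≤y-x = ≤-trans (≤-reflexive (sym (-‿inverseˡ x))) (+-monoʳ-≤ (- x) x≤y)

  *-monoʳ-≤ : ∀ {z} → 0# ≤ z → ∀ {x y} → x ≤ y → x * z ≤ y * z
  *-monoʳ-≤ 0≤z x≤y =
    ≤-trans (≤-reflexive (*-comm _ _)) (≤-trans (*-monoˡ-≤ 0≤z x≤y) (≤-reflexive (*-comm _ _)))

  -- By totality: if `1# ≤ 0#` then `- 1#` is nonnegative, and so is its square, which is `1#`.
  0≤1 : 0# ≤ 1#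
  0≤1 with total 0# 1#
  ... | inj₁ 0≤1 = 0≤1
  ... | inj₂ 1≤0 = begin
    0#             ≤⟨ *-nonNeg 0≤-1 0≤-1 ⟩
    - 1# * - 1#    ≈⟨ -‿distribʳ-* (- 1#) 1# ⟨
    - (- 1# * 1#)  ≈⟨ -‿cong (*-identityʳ (- 1#)) ⟩
    - (- 1#)       ≈⟨ -‿involutive 1# ⟩
    1#             ∎
    where
    0≤-1 : 0# ≤ - 1#
    0≤-1 = neg-nonNeg 1≤0

  1≰0 : ¬ 1# ≤ 0#
  1≰0 1≤0 = 0≉1 (antisym 0≤1 1≤0)

  1≤⇒0≤ : ∀ {x} → 1# ≤ x → 0# ≤ x
  1≤⇒0≤ = ≤-trans 0≤1

  1≤⇒0< : ∀ {x} → 1# ≤ x → 0# < x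
  1≤⇒0< 1≤x = 1≤⇒0≤ 1≤x , λ 0≈x → 1≰0 (≤-trans 1≤x (≤-reflexive (sym 0≈x)))

  -- A nonpositive inverse of a positive `x` would force `1# ≈ x * x ⁻¹ ≤ 0#`.
  ⁻¹-nonNeg : ∀ {x} → 0# < x → 0# ≤ x ⁻¹
  ⁻¹-nonNeg {x} (0≤x , 0≉x) with total 0# (x ⁻¹)
  ... | inj₁ 0≤x⁻¹ = 0≤x⁻¹
  ... | inj₂ x⁻¹≤0 = contradiction
    (begin
      1#        ≈⟨ ⁻¹-inverseʳ x (0≉x ∘ sym) ⟨
      x * x ⁻¹  ≤⟨ *-monoˡ-≤ 0≤x x⁻¹≤0 ⟩
      x * 0#    ≈⟨ zeroʳ x ⟩
      0#        ∎)
    1≰0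

  n·1-nonNeg : ∀ n → 0# ≤ n · 1#
  n·1-nonNeg ℕ.zero    = ≤-refl
  n·1-nonNeg (ℕ.suc n) = +-nonNeg 0≤1 (n·1-nonNeg n)

  x/1≈x : ∀ x → x / 1# ≈ x
  x/1≈x x = trans (*-congˡ 1⁻¹≈1) (*-identityʳ x)
    where
    1⁻¹≈1 : 1# ⁻¹ ≈ 1#
    1⁻¹≈1 = trans (sym (*-identityˡ _)) (⁻¹-inverseʳ 1# (0≉1 ∘ sym))

  sum-mono-≤ : ∀ {n} {f g : Fin n → Carrier} → (∀ i → f i ≤ g i) → sum f ≤ sum g
  sum-mono-≤ {ℕ.zero}  f≤g = ≤-refl
  sum-mono-≤ {ℕ.suc n} f≤g = +-mono-≤ (f≤g zero) (sum-mono-≤ (f≤g ∘ suc))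

  sum-nonNeg : ∀ {n} {f : Fin n → Carrier} → (∀ i → 0# ≤ f i) → 0# ≤ sum f
  sum-nonNeg {n} 0≤f = ≤-trans (≤-reflexive (sym (sum-replicate-zero n))) (sum-mono-≤ 0≤f)

  term≤sum : ∀ {n} {f : Fin n → Carrier} → (∀ i → 0# ≤ f i) → ∀ i → f i ≤ sum f
  term≤sum 0≤f zero    = x≤x+y (sum-nonNeg (0≤f ∘ suc))
  term≤sum 0≤f (suc i) = ≤-trans (term≤sum (0≤f ∘ suc) i) (x≤y+x (0≤f zero))

  sum-const : ∀ n x → sum {n} (const x) ≈ n · 1# * x
  sum-const ℕ.zero    x = sym (zeroˡ x)
  sum-const (ℕ.suc n) x = trans
    (+-cong (sym (*-identityˡ x)) (sum-const n x))
    (sym (distribʳ x 1# (n · 1#)))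

  sum-indicator : ∀ {n} (j : Fin n) x → sum (λ k → if does (k ≟ j) then x else 0#) ≈ x
  sum-indicator {ℕ.suc n} zero    x = trans (+-congˡ (sum-replicate-zero n)) (+-identityʳ x)
  sum-indicator           (suc j) x = trans (+-identityˡ _) (sum-indicator j x)

  if-nonNeg : ∀ b {x} → 0# ≤ x → 0# ≤ (if b then x else 0#)
  if-nonNeg true  0≤x = 0≤x
  if-nonNeg false 0≤x = ≤-refl

-- Maxima, loads and makespans.

module SchedulingProperties {c ℓ₁ ℓ₂} (K : ArchimedeanOrderedField c ℓ₁ ℓ₂) where

  open ArchimedeanOrderedField K
  open Scheduling K
  open OrderedFieldProperties K
  open PartialOrderReasoning poset

  maximum-upper : ∀ {k} (f : Fin (ℕ.suc k) → Carrier) i → f i ≤ maximum f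
  maximum-upper f zero    = Extrema.⊥≤max totalOrder (f zero) (tabulate (f ∘ suc))
  maximum-upper f (suc i) =
    tabulate⁻ {f = f ∘ suc} (Extrema.xs≤max totalOrder (f zero) (tabulate (f ∘ suc))) i

  maximum-least : ∀ {k} (f : Fin (ℕ.suc k) → Carrier) {v} → (∀ i → f i ≤ v) → maximum f ≤ v
  maximum-least f f≤v = Extrema.max≤v⁺ totalOrder (f≤v zero) (tabulate⁺ {f = f ∘ suc} (f≤v ∘ suc))

  ∃-argmax : ∀ {k} (f : Fin (ℕ.suc k) → Carrier) → ∃[ i ] (∀ j → f j ≤ f i)
  ∃-argmax f = _ , λ j →
    All.lookup (Extrema.f[xs]≤f[argmax] totalOrder {f = f} zero (allFin _)) (∈-allFin j)

  ∃-argmin : ∀ {k} (i₀ : Fin k) (f : Fin k → Carrier) → ∃[ i ] (∀ j → f i ≤ f j)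
  ∃-argmin i₀ f = _ , λ j →
    All.lookup (Extrema.f[argmin]≤f[xs] totalOrder {f = f} i₀ (allFin _)) (∈-allFin j)

  -- Schedules that agree only pointwise are allowed, because decoding the code of a schedule
  -- returns it up to pointwise equality.
  load-mono-≤ : ∀ {m n} {S S′ : Schedule m n} {q q′ : Scenario m n} →
                (∀ j → S j ≡ S′ j) → (∀ i j → q i j ≤ q′ i j) → ∀ i → load S q i ≤ load S′ q′ i
  load-mono-≤ {S = S} {q = q} {q′} S≗S′ q≤q′ i = sum-mono-≤ λ j →
    ≡.subst (λ k → (if does (S j ≟ i) then q i j else 0#) ≤ (if does (k ≟ i) then q′ i j else 0#))
            (S≗S′ j) (if-mono (does (S j ≟ i)) (q≤q′ i j))
    where
    if-mono : ∀ b {x y} → x ≤ y → (if b then x else 0#) ≤ (if b then y else 0#)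
    if-mono true  x≤y = x≤y
    if-mono false x≤y = ≤-refl

  load≤Cmax : ∀ {m n} (S : Schedule (ℕ.suc m) n) q i → load S q i ≤ Cmax S q
  load≤Cmax S q = maximum-upper (load S q)

  Cmax-least : ∀ {m n} (S : Schedule (ℕ.suc m) n) q {v} → (∀ i → load S q i ≤ v) → Cmax S q ≤ v
  Cmax-least S q = maximum-least (load S q)

  Cmax-mono-≤ : ∀ {m n} {S S′ : Schedule (ℕ.suc m) n} {q q′ : Scenario (ℕ.suc m) n} →
                (∀ j → S j ≡ S′ j) → (∀ i j → q i j ≤ q′ i j) → Cmax S q ≤ Cmax S′ q′
  Cmax-mono-≤ {S = S} {S′} {q} {q′} S≗S′ q≤q′ = Cmax-least S q λ i →
    ≤-trans (load-mono-≤ S≗S′ q≤q′ i) (load≤Cmax S′ q′ i)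

  -- The processing time of job `j` is one term of the load of its own machine, and the other terms
  -- are nonnegative.
  q≤Cmax : ∀ {m n} (S : Schedule (ℕ.suc m) n) {q} → (∀ i j → 0# ≤ q i j) →
           ∀ j → q (S j) j ≤ Cmax S q
  q≤Cmax S {q} 0≤q j = begin
    q (S j) j                                    ≡⟨ ≡.cong (if_then q (S j) j else 0#)
                                                      (dec-true (S j ≟ S j) ≡.refl) ⟨
    (if does (S j ≟ S j) then q (S j) j else 0#) ≤⟨ term≤sum
                                                      (λ k → if-nonNeg (does (S k ≟ S j)) (0≤q (S j) k)) j ⟩
    load S q (S j)                               ≤⟨ load≤Cmax S q (S j) ⟩
    Cmax S q                                     ∎

  -- Existence of the two optima by finite search.

  ∃-optimal : ∀ {m n} (f : Schedule (ℕ.suc m) n → Carrier) →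
              (∀ {S S′} → (∀ j → S j ≡ S′ j) → f S ≤ f S′) → ∃[ S ] (∀ S′ → f S ≤ f S′)
  -- The minimum is taken over codes. An arbitrary `S` is compared through `funToFin S`, whose
  -- decoding agrees with `S` pointwise, which is all that `f-mono` asks for.
  ∃-optimal {m} {n} f f-mono = finToFun (proj₁ best) , λ S → ≤-trans
    (proj₂ best (funToFin S)) (f-mono (finToFun-funToFin S))
    where
    best : ∃[ k ] (∀ l → f (finToFun {ℕ.suc m} {n} k) ≤ f (finToFun l))
    -- The search needs an index to start from: the code of the schedule that uses only machine
    -- `zero`.
    best = ∃-argmin (funToFin {n} {ℕ.suc m} (const zero)) (f ∘ finToFun)

  -- `Consistent` speaks about every `opt` with `IsOPT q̂ opt`, so it yields a bound only once such
  -- a value is produced.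
  OPT-exists : ∀ {m n} (q : Scenario (ℕ.suc m) n) →
               ∃[ opt ] (IsOPT q opt × (∀ S → opt ≤ Cmax S q))
  OPT-exists {m} {n} q =
      Cmax S q
    , ((S , refl) , λ { w (S′ , w≈) → ≤-trans (proj₂ optimum S′) (≤-reflexive (sym w≈)) })
    , proj₂ optimum
    where
    optimum : ∃[ S ] (∀ S′ → Cmax S q ≤ Cmax S′ q)
    optimum = ∃-optimal (λ S → Cmax S q) λ {S} {S′} S≗S′ →
      Cmax-mono-≤ {S = S} {S′} {q} {q} S≗S′ λ _ _ → ≤-refl

    S : Schedule (ℕ.suc m) n
    S = proj₁ optimum

  -- `𝒰` may be infinite, but makespans are monotone in the scenario, so a finite family of members
  -- that dominates all others already realises every worst case.
  OPTrob-exists : ∀ {m n k ℓ} {𝒰 : Scenario (ℕ.suc m) n → Set ℓ}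
    (F : Fin (ℕ.suc k) → Scenario (ℕ.suc m) n) → (∀ t → 𝒰 (F t)) →
    (∀ q → 𝒰 q → ∃[ t ] (∀ i j → q i j ≤ F t i j)) →
    ∃[ opt ] (IsOPTrob 𝒰 opt × (∀ S → ∃[ t ] opt ≤ Cmax S (F t)))
  OPTrob-exists {m} {n} {𝒰 = 𝒰} F F∈𝒰 F-dominates = W S , (isOPTrob , bound)
    where
    cost : Schedule (ℕ.suc m) n → Fin _ → Carrier
    cost S t = Cmax S (F t)

    W : Schedule (ℕ.suc m) n → Carrier
    W S = maximum (cost S)

    W-mono : ∀ {S S′} → (∀ j → S j ≡ S′ j) → W S ≤ W S′
    W-mono {S} {S′} S≗S′ = maximum-least (cost S) λ t → ≤-trans {cost S t} {cost S′ t}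
      (Cmax-mono-≤ {S = S} {S′} {F t} {F t} S≗S′ λ _ _ → ≤-refl) (maximum-upper (cost S′) t)

    optimum : ∃[ S ] (∀ S′ → W S ≤ W S′)
    optimum = ∃-optimal W W-mono

    S : Schedule (ℕ.suc m) n
    S = proj₁ optimum

    S-best : ∀ S′ → W S ≤ W S′
    S-best = proj₂ optimum

    attained : ∀ S → ∃[ t ] W S ≈ cost S t
    attained S = let t , t-max = ∃-argmax (cost S) in
      t , antisym {W S} {cost S t} (maximum-least (cost S) t-max) (maximum-upper (cost S) t)

    W-worst : ∀ S → IsWorstCase 𝒰 S (W S)
    W-worst S = (F (proj₁ (attained S)) , F∈𝒰 _ , proj₂ (attained S)) , upper
      where
      upper : ∀ w → ∃[ q ] (𝒰 q × w ≈ Cmax S q) → w ≤ W S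
      upper w (q , q∈𝒰 , w≈) = let t , q≤Ft = F-dominates q q∈𝒰 in begin
        w         ≈⟨ w≈ ⟩
        Cmax S q  ≤⟨ Cmax-mono-≤ {S = S} {S} {q} {F t} (λ _ → ≡.refl) q≤Ft ⟩
        cost S t  ≤⟨ maximum-upper (cost S) t ⟩
        W S       ∎

    isOPTrob : IsOPTrob 𝒰 (W S)
    -- A worst case `w` of `S′` is at least each `cost S′ t`, hence at least `W S′`.
    isOPTrob = (S , W-worst S) , λ { w (S′ , _ , w-upper) → ≤-trans {W S} {W S′} {w} (S-best S′)
      (maximum-least (cost S′) λ t → w-upper (cost S′ t) (F t , F∈𝒰 t , refl)) }

    bound : ∀ S′ → ∃[ t ] W S ≤ cost S′ t
    bound S′ = proj₁ (attained S′) , (begin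
      W S                             ≤⟨ S-best S′ ⟩
      W S′                            ≈⟨ proj₂ (attained S′) ⟩
      cost S′ (proj₁ (attained S′))  ∎)

  -- Extreme scenarios of a unit budget.

  module UnitBudget {m n} (speed : Fin (ℕ.suc m) → Carrier) (speed-pos : ∀ i → 0# < speed i)
                    (p⁻ p⁺ : Fin (ℕ.suc n) → Carrier) (p⁻≤p⁺ : ∀ j → p⁻ j ≤ p⁺ j) where

    raised : Fin (ℕ.suc n) → Scenario (ℕ.suc m) (ℕ.suc n)
    raised t i j = (if does (j ≟ t) then p⁺ j else p⁻ j) / speed i

    raised∈budget : ∀ t → CardinalityBudget speed p⁻ p⁺ 1 (raised t)
    raised∈budget t = _ , (⁅ t ⁆ , ℕₚ.≤-reflexive (∣⁅x⁆∣≡1 t) , outside , inside) , λ _ _ → refl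
      where
      size : Fin (ℕ.suc n) → Carrier
      size j = if does (j ≟ t) then p⁺ j else p⁻ j

      outside : ∀ j → j ∉ ⁅ t ⁆ → size j ≈ p⁻ j
      outside j j∉ with j ≟ t
      ... | yes ≡.refl = contradiction (x∈⁅x⁆ j) j∉
      ... | no _       = refl

      inside : ∀ j → j ∈ ⁅ t ⁆ → p⁻ j ≤ size j × size j ≤ p⁺ j
      inside j j∈ with j ≟ t
      ... | yes _  = p⁻≤p⁺ j , ≤-refl
      ... | no j≢t = contradiction (x∈⁅y⁆⇒x≡y t j∈) j≢t

    -- At most one job deviates, so raising that job fully gives sizes above those of `q`; dividing
    -- by positive speeds preserves the comparison.
    raised-dominates : ∀ q → CardinalityBudget speed p⁻ p⁺ 1 q →
                       ∃[ t ] (∀ i j → q i j ≤ raised t i j)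
    raised-dominates q (p , (T , ∣T∣≤1 , outside , inside) , q≈p/s) = proj₁ dominating , λ i j →
      ≤-trans (≤-reflexive (q≈p/s i j))
              (*-monoʳ-≤ (⁻¹-nonNeg (speed-pos i)) (proj₂ dominating j))
      where
      p⁻≤size : ∀ t j → p⁻ j ≤ (if does (j ≟ t) then p⁺ j else p⁻ j)
      p⁻≤size t j with does (j ≟ t)
      ... | true  = p⁻≤p⁺ j
      ... | false = ≤-refl

      -- If `j` and `t` were distinct, `j` would survive the removal of `t`, so `1 ≤ ∣T - t∣ < ∣T∣`,
      -- against the budget.
      T-unique : ∀ {j t} → j ∈ T → t ∈ T → ¬ j ≢ t
      T-unique j∈T t∈T j≢t = ℕₚ.<⇒≱
        (ℕₚ.≤-<-trans (ℕₚ.≤-<-trans z≤n (x∈p⇒∣p-x∣<∣p∣ (x∈p∧x≢y⇒x∈p-y j∈T j≢t)))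
                      (x∈p⇒∣p-x∣<∣p∣ t∈T))
        ∣T∣≤1

      dominating : ∃[ t ] (∀ j → p j ≤ (if does (j ≟ t) then p⁺ j else p⁻ j))
      dominating with any? (_∈? T)
      -- When no job deviates, every extreme scenario dominates; `zero` is an arbitrary choice.
      ... | no T-empty = zero , λ j →
              ≤-trans (≤-reflexive (outside j (λ j∈T → T-empty (j , j∈T)))) (p⁻≤size zero j)
      ... | yes (t , t∈T) = t , below
        where
        below : ∀ j → p j ≤ (if does (j ≟ t) then p⁺ j else p⁻ j)
        below j with j ≟ t
        ... | yes ≡.refl = proj₂ (inside j t∈T)
        ... | no j≢t     = ≤-reflexive (outside j λ j∈T → T-unique j∈T t∈T j≢t)

  -- Monotonicity and linearity of expectation.

  module _ {m n} (𝒮 : RandomSchedule m n) where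

    open RandomSchedule 𝒮

    private
      P : Fin (m ℕ.^ n) → Carrier
      P k = prob (finToFun k)

    𝔼-mono-≤ : ∀ {f g} → (∀ S → f S ≤ g S) → 𝔼 𝒮 f ≤ 𝔼 𝒮 g
    𝔼-mono-≤ f≤g = sum-mono-≤ λ k → *-monoˡ-≤ (prob-nonNeg (finToFun k)) (f≤g (finToFun k))

    𝔼-const : ∀ x → 𝔼 𝒮 (const x) ≈ x
    𝔼-const x = trans (sym (*-distribʳ-sum x P)) (trans (*-congʳ prob-total) (*-identityˡ x))

    𝔼-distrib-+ : ∀ f g → 𝔼 𝒮 (λ S → f S + g S) ≈ 𝔼 𝒮 f + 𝔼 𝒮 g
    𝔼-distrib-+ f g = trans
      (sum-cong-≋ λ k → distribˡ (P k) (f (finToFun k)) (g (finToFun k)))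
      (∑-distrib-+ (λ k → P k * f (finToFun k)) (λ k → P k * g (finToFun k)))

    𝔼-*ˡ : ∀ x f → 𝔼 𝒮 (λ S → x * f S) ≈ x * 𝔼 𝒮 f
    𝔼-*ˡ x f = trans
      (sum-cong-≋ λ k → trans (sym (*-assoc _ _ _))
                          (trans (*-congʳ (*-comm (P k) x)) (*-assoc _ _ _)))
      (sym (*-distribˡ-sum x (λ k → P k * f (finToFun k))))

    𝔼-sum : ∀ {l} (f : Fin l → Schedule m n → Carrier) →
            𝔼 𝒮 (λ S → sum (λ t → f t S)) ≈ sum (λ t → 𝔼 𝒮 (f t))
    𝔼-sum f = trans
      (sum-cong-≋ λ k → *-distribˡ-sum (P k) (λ t → f t (finToFun k)))
      (∑-comm (λ k t → P k * f t (finToFun k)))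

-- The hard instance and its consistency-robustness tradeoff.

module HardInstance {c ℓ₁ ℓ₂} (K : ArchimedeanOrderedField c ℓ₁ ℓ₂) where

  open ArchimedeanOrderedField K
  open Scheduling K
  open OrderedFieldProperties K
  open SchedulingProperties K
  open SemiringSolver commutativeSemiring using (solve; _:=_; _:+_; _:*_)
  open PartialOrderReasoning poset

  module _ (s : Carrier) (s-pos : 0# < s) (n-1 : ℕ) where

    n : ℕ
    n = ℕ.suc n-1

    N : Carrier
    N = n · 1#

    -- There are as many unit-speed machines as jobs, so that `spread` can give each job a machine
    -- of its own.
    speed : Fin (ℕ.suc n) → Carrier
    speed zero    = s
    speed (suc _) = 1#

    speed-pos : ∀ i → 0# < speed i
    speed-pos zero    = s-pos
    speed-pos (suc _) = 0≤1 , 0≉1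

    -- Growth by `N` makes a single grown job cost more than `N` on a slow machine, while the total
    -- size merely doubles from `N` to `N + N`.
    p⁻ p⁺ : Fin n → Carrier
    p⁻ _ = 1#
    p⁺ _ = 1# + N

    0≤N : 0# ≤ N
    0≤N = n·1-nonNeg n

    p⁻≤p⁺ : ∀ j → p⁻ j ≤ p⁺ j
    p⁻≤p⁺ _ = x≤x+y 0≤N

    q̂ : Scenario (ℕ.suc n) n
    q̂ i j = p⁻ j / speed i

    hard : Instance
    hard = record
      { m-1 = n ; n = n ; speed = speed ; speed-pos = speed-pos
      ; p⁻ = p⁻ ; p⁺ = p⁺ ; 0≤p⁻ = λ _ → 0≤1 ; p⁻≤p⁺ = p⁻≤p⁺
      ; Γ = 1 ; 1≤Γ = s≤s z≤n
      ; q̂ = q̂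
      ; q̂∈𝒰 = p⁻ , (⊥ , ℕₚ.≤-trans (ℕₚ.≤-reflexive (∣⊥∣≡0 n)) z≤n , (λ _ _ → refl)
                       , λ _ j∈⊥ → contradiction j∈⊥ ∉⊥)
                   , λ _ _ → refl
      }

    open UnitBudget speed speed-pos p⁻ p⁺ p⁻≤p⁺
      renaming (raised to q⁺; raised∈budget to q⁺∈𝒰; raised-dominates to q⁺-dominates)

    /speed-nonNeg : ∀ {x} → 0# ≤ x → ∀ i → 0# ≤ x / speed i
    /speed-nonNeg 0≤x i = *-nonNeg 0≤x (⁻¹-nonNeg (speed-pos i))

    q⁺-nonNeg : ∀ t i j → 0# ≤ q⁺ t i j
    q⁺-nonNeg t i j with does (j ≟ t)
    ... | true  = /speed-nonNeg (+-nonNeg 0≤1 0≤N) i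
    ... | false = /speed-nonNeg 0≤1 i

    spread allFast : Schedule (ℕ.suc n) n
    spread j  = suc j
    allFast _ = zero

    Cmax-spread : Cmax spread q̂ ≤ 1#
    Cmax-spread = Cmax-least spread q̂ λ where
      zero    → ≤-trans (≤-reflexive (sum-replicate-zero n)) 0≤1
      (suc i) → ≤-reflexive (trans (sum-indicator i (1# / 1#)) (x/1≈x 1#))

    -- The base sizes sum to `N` and exactly one job adds a further `N`; all of it runs at speed
    -- `s`.
    Cmax-allFast : ∀ t → Cmax allFast (q⁺ t) ≤ (N + N) / s
    Cmax-allFast t = Cmax-least allFast (q⁺ t) λ where
        zero    → ≤-reflexive fast
        (suc i) → ≤-trans (≤-reflexive (sum-replicate-zero n)) (/speed-nonNeg (+-nonNeg 0≤N 0≤N) zero)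
      where
      split : ∀ b → (if b then 1# + N else 1#) ≈ 1# + (if b then N else 0#)
      split true  = refl
      split false = sym (+-identityʳ 1#)

      fast : load allFast (q⁺ t) zero ≈ (N + N) / s
      fast = trans (sym (*-distribʳ-sum (s ⁻¹) (λ j → if does (j ≟ t) then 1# + N else 1#))) (*-congʳ
        (trans (sum-cong-≋ λ j → split (does (j ≟ t)))
        (trans (∑-distrib-+ {n} (const 1#) (λ j → if does (j ≟ t) then N else 0#))
               (+-cong (trans (sum-const n 1#) (*-identityʳ N)) (sum-indicator t N)))))

    onFast : Schedule (ℕ.suc n) n → Fin n → Carrier
    onFast S j = if does (S j ≟ zero) then 1# else 0#

    -- A fast job takes time `1# / s` under the prediction, so the number of fast jobs is exactly
    -- `s` times the load of machine `zero`.
    fast-load : ∀ S → sum (onFast S) ≤ s * Cmax S q̂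
    fast-load S = begin
      sum (onFast S)                                             ≈⟨ sum-cong-≋ (λ j → scale (does (S j ≟ zero))) ⟨
      sum (λ j → s * (if does (S j ≟ zero) then 1# / s else 0#)) ≈⟨ *-distribˡ-sum s (λ j → if does (S j ≟ zero) then 1# / s else 0#) ⟨
      s * load S q̂ zero                                          ≤⟨ *-monoˡ-≤ (proj₁ s-pos) (load≤Cmax S q̂ zero) ⟩
      s * Cmax S q̂                                               ∎
      where
      scale : ∀ b → s * (if b then 1# / s else 0#) ≈ (if b then 1# else 0#)
      scale true  = trans (*-congˡ (*-identityˡ _)) (⁻¹-inverseʳ s (proj₂ s-pos ∘ sym))
      scale false = zeroʳ s

    raised-cost : ∀ S j → N ≤ N * onFast S j + Cmax S (q⁺ j)
    -- The machine of `j` becomes a variable `i` and the makespan a bound `v`, so that a case split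
    -- on `i` reduces both the indicator and the speed.
    raised-cost S j = byMachine (S j) (q≤Cmax S (q⁺-nonNeg j) j)
      where
      byMachine : ∀ i {v} → q⁺ j i j ≤ v → N ≤ N * (if does (i ≟ zero) then 1# else 0#) + v
      byMachine zero {v} q≤v = begin
        N           ≈⟨ *-identityʳ N ⟨
        N * 1#      ≤⟨ x≤x+y (≤-trans (q⁺-nonNeg j zero j) q≤v) ⟩
        N * 1# + v  ∎
      byMachine (suc i) {v} q≤v = begin
        N                ≤⟨ x≤y+x 0≤1 ⟩
        1# + N           ≈⟨ x/1≈x (1# + N) ⟨
        -- `j ≟ j` does not reduce for a variable `j`, so its decision is rewritten to `true` to
        -- expose the raised size.
        (1# + N) / 1#    ≡⟨ ≡.cong (λ b → (if b then 1# + N else 1#) / 1#) (dec-true (j ≟ j) ≡.refl) ⟨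
        q⁺ j (suc i) j   ≤⟨ q≤v ⟩
        v                ≈⟨ +-identityˡ v ⟨
        0# + v           ≈⟨ +-congʳ (zeroʳ N) ⟨
        N * 0# + v       ∎

    -- Each job is tried in turn as the one that grows. The bound holds for every fixed schedule and
    -- is linear in the makespans, so it survives averaging.
    tradeoff : ∀ S → N * N ≤ N * (s * Cmax S q̂) + sum (λ j → Cmax S (q⁺ j))
    tradeoff S = begin
      N * N                                                   ≈⟨ sum-const n N ⟨
      sum {n} (const N)                                       ≤⟨ sum-mono-≤ (raised-cost S) ⟩
      sum (λ j → N * onFast S j + Cmax S (q⁺ j))              ≈⟨ ∑-distrib-+ (λ j → N * onFast S j) (λ j → Cmax S (q⁺ j)) ⟩
      sum (λ j → N * onFast S j) + sum (λ j → Cmax S (q⁺ j))  ≈⟨ +-congʳ (*-distribˡ-sum N (onFast S)) ⟨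
      N * sum (onFast S) + sum (λ j → Cmax S (q⁺ j))          ≤⟨ +-mono-≤ (*-monoˡ-≤ 0≤N (fast-load S)) ≤-refl ⟩
      N * (s * Cmax S q̂) + sum (λ j → Cmax S (q⁺ j))          ∎

    tradeoff-𝔼 : ∀ 𝒮 → N * N ≤ N * (s * 𝔼 𝒮 (λ S → Cmax S q̂)) + sum (λ j → 𝔼 𝒮 (λ S → Cmax S (q⁺ j)))
    tradeoff-𝔼 𝒮 = begin
      N * N
        ≈⟨ 𝔼-const 𝒮 (N * N) ⟨
      𝔼 𝒮 (const (N * N))
        ≤⟨ 𝔼-mono-≤ 𝒮 tradeoff ⟩
      𝔼 𝒮 (λ S → N * (s * Cmax S q̂) + sum (λ j → Cmax S (q⁺ j)))
        ≈⟨ 𝔼-distrib-+ 𝒮 (λ S → N * (s * Cmax S q̂)) (λ S → sum (λ j → Cmax S (q⁺ j))) ⟩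
      𝔼 𝒮 (λ S → N * (s * Cmax S q̂)) + 𝔼 𝒮 (λ S → sum (λ j → Cmax S (q⁺ j)))
        ≈⟨ +-cong (trans (𝔼-*ˡ 𝒮 N (λ S → s * Cmax S q̂)) (*-congˡ (𝔼-*ˡ 𝒮 s (λ S → Cmax S q̂))))
                  (𝔼-sum 𝒮 (λ j S → Cmax S (q⁺ j))) ⟩
      N * (s * 𝔼 𝒮 (λ S → Cmax S q̂)) + sum (λ j → 𝔼 𝒮 (λ S → Cmax S (q⁺ j)))
        ∎

    -- `spread` and `allFast` serve as competitors that bound the two optima from above; the signs
    -- of `α` and `β` allow these bounds to replace the optima.
    consistent-robust⇒ : ∀ {α β} → 0# ≤ α → 0# ≤ β → ∀ 𝒮 → Consistent hard α 𝒮 → Robust hard β 𝒮 →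
                         N * N ≤ N * (s * α) + N * (β * ((N + N) / s))
    consistent-robust⇒ {α} {β} 0≤α 0≤β 𝒮 consistent robust = begin
      N * N
        ≤⟨ tradeoff-𝔼 𝒮 ⟩
      N * (s * 𝔼 𝒮 (λ S → Cmax S q̂)) + sum (λ j → 𝔼 𝒮 (λ S → Cmax S (q⁺ j)))
        ≤⟨ +-mono-≤ (*-monoˡ-≤ 0≤N (*-monoˡ-≤ (proj₁ s-pos) 𝔼q̂≤α)) (sum-mono-≤ 𝔼q⁺≤) ⟩
      N * (s * α) + sum {n} (const (β * ((N + N) / s)))
        ≈⟨ +-congˡ (sum-const n _) ⟩
      N * (s * α) + N * (β * ((N + N) / s))
        ∎
      where
      𝔼q̂≤α : 𝔼 𝒮 (λ S → Cmax S q̂) ≤ α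
      𝔼q̂≤α = let opt , isOPT , opt≤ = OPT-exists q̂ in begin
        𝔼 𝒮 (λ S → Cmax S q̂)  ≤⟨ consistent opt isOPT ⟩
        α * opt                ≤⟨ *-monoˡ-≤ 0≤α (≤-trans (opt≤ spread) Cmax-spread) ⟩
        α * 1#                 ≈⟨ *-identityʳ α ⟩
        α                      ∎

      𝔼q⁺≤ : ∀ j → 𝔼 𝒮 (λ S → Cmax S (q⁺ j)) ≤ β * ((N + N) / s)
      𝔼q⁺≤ j =
        let opt , isOPTrob , opt≤ = OPTrob-exists {𝒰 = Instance.𝒰 hard} q⁺ q⁺∈𝒰 q⁺-dominates
            t , opt≤t = opt≤ allFast
        in begin
        𝔼 𝒮 (λ S → Cmax S (q⁺ j))  ≤⟨ robust opt isOPTrob (q⁺ j) (q⁺∈𝒰 j) ⟩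
        β * opt                     ≤⟨ *-monoˡ-≤ 0≤β (≤-trans opt≤t (Cmax-allFast t)) ⟩
        β * ((N + N) / s)           ∎

  -- Choice of parameters and contradiction.

  refutation : ∀ {α β} → 1# ≤ α → 1# ≤ β → let s = (β + β) + (β + β) in (s-pos : 0# < s) →
               ∀ n-1 → s * α + s * α ≤ n-1 · 1# → ∀ 𝒮 →
               ¬ (Consistent (hard s s-pos n-1) α 𝒮 × Robust (hard s s-pos n-1) β 𝒮)
  refutation {α} {β} 1≤α 1≤β s-pos n-1 2sα≤n-1 𝒮 (consistent , robust) = 1≰0 (begin
      1#  ≤⟨ x≤x+y (n·1-nonNeg n-1) ⟩
      M   ≤⟨ +-cancelˡ-≤ (M * (s * α + s * α) + M * M) final ⟩
      0#  ∎)
    where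
    s M r : Carrier
    s = (β + β) + (β + β)
    -- This equals, by computation, the `N` of the instance with `suc n-1` jobs.
    M = 1# + n-1 · 1#
    r = s ⁻¹

    -- Adding `bound` to itself avoids halving: as `s` is four times `β`, the doubled robustness
    -- term collapses to `M * M`. On the other side, one copy of `M * M` is at least
    -- `M * (1# + (s * α + s * α))`, which leaves a surplus of `M`.
    final : M * (s * α + s * α) + M * M + M ≤ M * (s * α + s * α) + M * M + 0#
    final = begin
      M * (s * α + s * α) + M * M + M
        ≈⟨ +-congˡ (*-identityʳ M) ⟨
      M * (s * α + s * α) + M * M + M * 1#
        ≈⟨ solve 3 (λ m y e → m :* y :+ m :* m :+ m :* e := m :* m :+ m :* (e :+ y)) refl M (s * α + s * α) 1# ⟩
      M * M + M * (1# + (s * α + s * α))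
        ≤⟨ +-monoʳ-≤ (M * M) (*-monoˡ-≤ (n·1-nonNeg (ℕ.suc n-1)) (+-monoʳ-≤ 1# 2sα≤n-1)) ⟩
      M * M + M * M
        ≤⟨ +-mono-≤ bound bound ⟩
      (M * (s * α) + M * (β * ((M + M) / s))) + (M * (s * α) + M * (β * ((M + M) / s)))
        ≈⟨ solve 4 (λ m x b r → (m :* x :+ m :* (b :* ((m :+ m) :* r))) :+ (m :* x :+ m :* (b :* ((m :+ m) :* r)))
                                := m :* (x :+ x) :+ m :* m :* (((b :+ b) :+ (b :+ b)) :* r)) refl M (s * α) β r ⟩
      M * (s * α + s * α) + M * M * (s * r)
        ≈⟨ +-congˡ (trans (*-congˡ (⁻¹-inverseʳ s (proj₂ s-pos ∘ sym))) (*-identityʳ _)) ⟩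
      M * (s * α + s * α) + M * M
        ≈⟨ +-identityʳ _ ⟨
      M * (s * α + s * α) + M * M + 0#
        ∎
      where
      bound : M * M ≤ M * (s * α) + M * (β * ((M + M) / s))
      bound = consistent-robust⇒ s s-pos n-1 (1≤⇒0≤ 1≤α) (1≤⇒0≤ 1≤β) 𝒮 consistent robust

theorem9 : ∀ {c ℓ₁ ℓ₂} (K : ArchimedeanOrderedField c ℓ₁ ℓ₂) →
    let open ArchimedeanOrderedField K
        open Scheduling K
    in (α β : Carrier) → 1# ≤ α → 1# ≤ β →
       Σ[ I ∈ Instance ]
         ( Instance.Γ I ≡ 1
         × ¬ (Σ[ 𝒮 ∈ RandomSchedule (Instance.m I) (Instance.n I) ]
                (Consistent I α 𝒮 × Robust I β 𝒮)))
theorem9 K α β 1≤α 1≤β = hard s s-pos n-1 , ≡.refl , λ (𝒮 , both) →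
    refutation 1≤α 1≤β s-pos n-1 2sα≤n-1 𝒮 both
  where
  open ArchimedeanOrderedField K
  open OrderedFieldProperties K
  open HardInstance K

  s : Carrier
  s = (β + β) + (β + β)

  s-pos : 0# < s
  s-pos = 1≤⇒0< (≤-trans 1≤β (≤-trans (x≤x+y 0≤β) (x≤x+y (+-nonNeg 0≤β 0≤β))))
    where
    0≤β : 0# ≤ β
    0≤β = 1≤⇒0≤ 1≤β

  n-1 : ℕ
  -- The Archimedean bound is weak; one job more than it supplies makes the number of jobs exceed
  -- `s * α + s * α` strictly.
  n-1 = proj₁ (archimedean (s * α + s * α))

  2sα≤n-1 : s * α + s * α ≤ n-1 · 1#
  2sα≤n-1 = proj₂ (archimedean (s * α + s * α))
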